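{- If a graph does not contain a long wheel as a subgraph, then it is 4-colorable.
   Context: Graphs are finite, simple and undirected. A wheel in a graph $G$ consists of a cycle $C$ of $G$ (as a subgraph, not necessarily induced; called the rim) and a vertex $v\in V(G)\setminus V(C)$ (the center) having at least three neighbors in $V(C)$. A long wheel is a wheel whose rim is a cycle of length at least 4. -}

module Defs where

open import Level using (0ℓ)
open import Data.Nat.Base using (ℕ; _≤_)
open import Data.Fin.Base using (Fin)
open import Data.List.Base using (List; _∷_; _∷ʳ_; length)
open import Data.List.Membership.Propositional using (_∈_; _∉_)
open import Data.List.Relation.Unary.All using (All)
open import Data.List.Relation.Unary.Linked using (Linked)
open import Data.List.Relation.Unary.Unique.Propositional using (Unique)
open import Data.Product.Base using (Σ-syntax)
open import Relation.Binary.Core using (Rel)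
open import Relation.Binary.Definitions using (Decidable; Irreflexive; Symmetric)
open import Relation.Binary.PropositionalEquality using (_≡_; _≢_)

-- Classically every relation on Fin n is decidable; constructively, a finite
-- graph is given with its adjacency test.
record Graph (n : ℕ) : Set₁ where
  infix 4 _~_
  field
    _~_    : Rel (Fin n) 0ℓ
    sym    : Symmetric _~_
    irrefl : Irreflexive _≡_ _~_
    _~?_   : Decidable _~_

module _ {n : ℕ} (G : Graph n) where
  open Graph G

  -- A cycle, not necessarily induced, listed in cyclic order from an arbitrary
  -- base vertex. In `closed` the base vertex is repeated at the end of the
  -- list, so that the edge back to it is among the consecutive pairs.
  record Cycle : Set where
    field
      base : Fin n
      rest : List (Fin n)

    vertices : List (Fin n)
    vertices = base ∷ rest

    field
      distinct : Unique vertices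
      closed   : Linked _~_ (vertices ∷ʳ base)
      size≥3   : 3 ≤ length vertices

  record Wheel : Set where
    field
      rim : Cycle

    open Cycle rim using (vertices) public

    field
      center           : Fin n
      center∉rim       : center ∉ vertices
      spokes           : List (Fin n)
      spokes-distinct  : Unique spokes
      spokes⊆rim       : All (_∈ vertices) spokes
      spokes-adjacent  : All (center ~_) spokes
      spokes≥3         : 3 ≤ length spokes

  LongWheel : Set
  LongWheel = Σ[ W ∈ Wheel ] 4 ≤ length (Wheel.vertices W)

  Colorable : ℕ → Set
  Colorable k = Σ[ c ∈ (Fin n → Fin k) ] (∀ u v → u ~ v → c u ≢ c v)

{-# OPTIONS --safe #-}
-- A graph without a long wheel has a vertex of degree at most 3, so it can be
-- coloured greedily. Suppose all degrees are at least 4. Among the longest paths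
-- v₁ v₂ … take one for which the second neighbour v_a of v₁ along the path comes
-- as early as possible, and put w = v_{a-1}. Reversing v₁ … w gives another
-- longest path, now starting at w. All neighbours of v₁ and of w lie on the path,
-- and by the choice of a each of the two has at most one of them before v_a.
-- So v₁ and w both have at least three neighbours on the tail v_a v_{a+1} …, and
-- both are adjacent to v_a. Take the shortest initial segment of the tail that
-- contains three neighbours of each. Its last vertex is adjacent to v₁ or to w;
-- that vertex closes the segment to a cycle, and the other one is the centre of
-- a long wheel.
module Submission where

open import Defs
open import Data.Nat.Base using (ℕ; zero; suc; _+_; _≤_; _<_; z≤n; s≤s; s≤s⁻¹)
open import Data.Nat.Properties
  using (_≤?_; ≤-refl; ≤-reflexive; ≤-trans; <-≤-trans; m≤n⇒m≤1+n;
         1+n≰n; ≰⇒>; +-suc; +-comm; +-identityʳ; +-monoˡ-≤)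
open import Data.Fin.Base using (Fin; zero)
open import Data.Fin.Properties using (_≟_; ¬∀⟶∃¬)
open import Data.List.Base
  using (List; []; _∷_; _∷ʳ_; [_]; _++_; _ʳ++_; length; filter; map; reverse;
         head; _∷ʳ′_; initLast)
open import Data.List.Properties
  using (length-++; length-map; length-reverse; length-tabulate; filter-++; filter-reject;
         filter-notAll; length-filter; ʳ++-defn; ++-ʳ++; ∷ʳ-++;
         reverse-++; ++-identityʳ)
open import Data.List.Reverse using (Reverse; []; _∶_∶ʳ_; reverseView)
open import Data.List.Membership.Propositional using (_∈_; _∉_; find; lose)
open import Data.List.Membership.Propositional.Properties
  using (∈-∃++; ∈-allFin; ∈-filter⁺; ∈-filter⁻; ∈-map⁺; ∈-++⁺ʳ)
open import Data.List.Membership.DecPropositional using (_∈?_)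
open import Data.List.Relation.Binary.Permutation.Propositional
  using (_↭_; ↭-sym; ↭-trans; ↭-reflexive; ↭⇒↭ₛ)
open import Data.List.Relation.Binary.Permutation.Propositional.Properties
  using (↭-length; ∈-resp-↭; All-resp-↭; shift; ↭-reverse; ++⁺ʳ)
open import Data.List.Relation.Binary.Permutation.Setoid.Properties using (Unique-resp-↭)
open import Data.List.Relation.Binary.Subset.Propositional using (_⊆_)
open import Data.List.Relation.Unary.All as All using (All; []; _∷_; all?)
open import Data.List.Relation.Unary.All.Properties
  using (¬Any⇒All¬; ¬All⇒Any¬; all-filter)
  renaming (++⁻ˡ to All-++⁻ˡ; ++⁻ʳ to All-++⁻ʳ)
open import Data.List.Relation.Unary.AllPairs using (AllPairs; []; _∷_)
open import Data.List.Relation.Unary.Any using (here; there; any?)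
open import Data.List.Relation.Unary.Linked as Linked using (Linked; []; [-]; _∷_)
import Data.List.Relation.Unary.Linked.Properties as Linked
open import Data.List.Relation.Unary.Unique.Propositional using (Unique)
open import Data.List.Relation.Unary.Unique.Propositional.Properties
  using (allFin⁺; Unique[x∷xs]⇒x∉xs) renaming (filter⁺ to Unique-filter⁺)
open import Data.Maybe.Base using (just)
open import Data.Maybe.Relation.Binary.Connected using (Connected; just)
open import Data.Product.Base using (Σ-syntax; _,_; proj₁; proj₂)
open import Function.Base using (_∘_; id)
open import Level using (Level)
open import Relation.Binary.Core using (Rel)
open import Relation.Binary.Definitions using (Symmetric)
open import Relation.Binary.PropositionalEquality
  using (_≡_; _≢_; refl; sym; trans; cong; subst; setoid; ≢-sym)
open import Relation.Nullary.Decidable using (Dec; yes; no; ¬?)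
open import Relation.Nullary.Negation using (¬_; contradiction)

-- Lists: splitting, reversal and counting.

private
  variable
    a ℓ : Level
    A : Set a
    R : Rel A ℓ
    x : A
    xs ys : List A

AllPairs-++⁻ˡ : ∀ xs → AllPairs R (xs ++ ys) → AllPairs R xs
AllPairs-++⁻ˡ []       _         = []
AllPairs-++⁻ˡ (x ∷ xs) (px ∷ ps) = All-++⁻ˡ xs px ∷ AllPairs-++⁻ˡ xs ps

AllPairs-++⁻ʳ : ∀ xs → AllPairs R (xs ++ ys) → AllPairs R ys
AllPairs-++⁻ʳ []       ps       = ps
AllPairs-++⁻ʳ (x ∷ xs) (_ ∷ ps) = AllPairs-++⁻ʳ xs ps

Linked-++⁻ˡ : ∀ xs → Linked R (xs ++ ys) → Linked R xs
Linked-++⁻ˡ []           _        = []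
Linked-++⁻ˡ (x ∷ [])     _        = [-]
Linked-++⁻ˡ (x ∷ y ∷ xs) (r ∷ rs) = r ∷ Linked-++⁻ˡ (y ∷ xs) rs

Linked-++⁻ʳ : ∀ xs → Linked R (xs ++ ys) → Linked R ys
Linked-++⁻ʳ []       rs = rs
Linked-++⁻ʳ (x ∷ xs) rs = Linked-++⁻ʳ xs (Linked.tail rs)

length-∷ʳ : ∀ (xs : List A) → length (xs ∷ʳ x) ≡ suc (length xs)
length-∷ʳ xs = trans (length-++ xs) (+-comm _ 1)

Linked-∷ʳ⁺ : ∀ xs {x y} → Linked R (xs ∷ʳ x) → R x y → Linked R (xs ∷ʳ x ∷ʳ y)
Linked-∷ʳ⁺ []           _        Rxy = Rxy ∷ [-]
Linked-∷ʳ⁺ (z ∷ [])     (r ∷ rs) Rxy = r ∷ Linked-∷ʳ⁺ [] rs Rxy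
Linked-∷ʳ⁺ (z ∷ u ∷ xs) (r ∷ rs) Rxy = r ∷ Linked-∷ʳ⁺ (u ∷ xs) rs Rxy

-- Entries of `xs` move onto `ys` one at a time, and each link of `xs` reappears backwards, whence
-- the symmetry. The only new link joins the two heads.
Linked-ʳ++⁺ : Symmetric R → Linked R xs → Connected R (head xs) (head ys) →
              Linked R ys → Linked R (xs ʳ++ ys)
Linked-ʳ++⁺ R-sym []       _ Rys = Rys
Linked-ʳ++⁺ R-sym [-]      c Rys = Linked.++⁺ [-] c Rys
Linked-ʳ++⁺ R-sym (r ∷ rs) c Rys =
  Linked-ʳ++⁺ R-sym rs (just (R-sym r)) (Linked.++⁺ [-] c Rys)

-- Cutting one occurrence of `x` out of `ys` keeps every later entry of `x ∷ xs`, since these differ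
-- from `x`; so induction applies.
Unique⇒length-≤ : Unique xs → xs ⊆ ys → length xs ≤ length ys
Unique⇒length-≤ {xs = []} _ _ = z≤n
Unique⇒length-≤ {xs = x ∷ xs} x∷xs!@(_ ∷ xs!) xs⊆ys with ∈-∃++ (xs⊆ys (here refl))
... | us , vs , refl =
  ≤-trans (s≤s (Unique⇒length-≤ xs! xs⊆us++vs)) (≤-reflexive (sym (↭-length (shift x us vs))))
  where
  xs⊆us++vs : xs ⊆ us ++ vs
  xs⊆us++vs u∈xs with ∈-resp-↭ (shift x us vs) (xs⊆ys (there u∈xs))
  ... | here refl = contradiction u∈xs (Unique[x∷xs]⇒x∉xs x∷xs!)
  ... | there u∈  = u∈

-- Pigeonhole: a list that contains all `k` colours has length at least `k`.
∃-fresh : ∀ {k} (cs : List (Fin k)) → length cs < k → Σ[ c ∈ Fin k ] c ∉ cs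
∃-fresh {k} cs cs<k = ¬∀⟶∃¬ k (_∈ cs) (λ c → _∈?_ _≟_ c cs) λ all∈ →
  1+n≰n (≤-trans cs<k (≤-trans (≤-reflexive (sym (length-tabulate {n = k} id)))
    (Unique⇒length-≤ (allFin⁺ k) λ {c} _ → all∈ c)))

-- Degrees into a list, and wheels from two paths with a common tail.

module _ {n : ℕ} (G : Graph n) where
  open Graph G renaming (sym to ~-sym; irrefl to ~-irrefl)

  -- Taken in a vertex list `L`, this is the degree in the subgraph induced by `L`; taken in a
  -- segment of a path, it counts neighbours along the path.
  deg : Fin n → List (Fin n) → ℕ
  deg v xs = length (filter (v ~?_) xs)

  deg-++ : ∀ v xs ys → deg v (xs ++ ys) ≡ deg v xs + deg v ys
  deg-++ v xs ys =
    trans (cong length (filter-++ (v ~?_) xs ys)) (length-++ (filter (v ~?_) xs))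

  deg-last : ∀ {k} v xs z → k ≤ deg v (xs ∷ʳ z) → ¬ k ≤ deg v xs → v ~ z
  deg-last {k} v xs z k≤ k≰ with v ~? z
  ... | yes v~z = v~z
  ... | no  v≁z = contradiction (subst (k ≤_) eq k≤) k≰
    where
    eq : deg v (xs ∷ʳ z) ≡ deg v xs
    eq = trans (deg-++ v xs [ z ])
      (trans (cong (λ zs → deg v xs + length zs) (filter-reject (v ~?_) v≁z))
        (+-identityʳ _))

  deg-tail : ∀ {k} v xs ys → suc k ≤ deg v (xs ++ ys) → ¬ 2 ≤ deg v xs → k ≤ deg v ys
  deg-tail v xs ys k<deg 2≰deg = s≤s⁻¹ (≤-trans (subst (_ ≤_) (deg-++ v xs ys) k<deg)
    (+-monoˡ-≤ _ (s≤s⁻¹ (≰⇒> 2≰deg))))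

  -- The spokes counted end at rim vertices other than `v`, so the rim has at least four vertices.
  cycle-wheel : ∀ {w v} xs z → Unique (v ∷ xs ∷ʳ z) → w ∉ v ∷ xs ∷ʳ z →
                Linked _~_ (v ∷ xs ∷ʳ z) → z ~ v → 3 ≤ deg w (xs ∷ʳ z) → LongWheel G
  cycle-wheel {w} {v} xs z uniq w∉ linked z~v 3≤deg = record
    { rim = record
      { base     = v
      ; rest     = xs ∷ʳ z
      ; distinct = uniq
      ; closed   = Linked-∷ʳ⁺ (v ∷ xs) linked z~v
      ; size≥3   = m≤n⇒m≤1+n 3≤rest
      }
    ; center          = w
    ; center∉rim      = w∉
    ; spokes          = filter (w ~?_) (xs ∷ʳ z)
    ; spokes-distinct = Unique-filter⁺ (w ~?_) (AllPairs-++⁻ʳ [ v ] uniq)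
    ; spokes⊆rim      = All.tabulate (there ∘ proj₁ ∘ ∈-filter⁻ (w ~?_))
    ; spokes-adjacent = all-filter (w ~?_) (xs ∷ʳ z)
    ; spokes≥3        = 3≤deg
    } , s≤s 3≤rest
    where
    3≤rest : 3 ≤ length (xs ∷ʳ z)
    3≤rest = ≤-trans 3≤deg (length-filter (w ~?_) (xs ∷ʳ z))

  -- The last vertex of `xs` is dropped as long as both counts stay at least 3; the `Reverse` view
  -- makes this recursion structural.
  two-ends-wheel : ∀ {v w xs} → Reverse xs → v ≢ w → Unique (v ∷ xs) → Unique (w ∷ xs) →
                   Linked _~_ (v ∷ xs) → Linked _~_ (w ∷ xs) →
                   3 ≤ deg v xs → 3 ≤ deg w xs → LongWheel G
  two-ends-wheel {v} {w} (xs ∶ rs ∶ʳ z) v≢w v! w! v~ w~ 3≤v 3≤w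
    with 3 ≤? deg v xs | 3 ≤? deg w xs
  ... | yes 3≤v′ | yes 3≤w′ = two-ends-wheel rs v≢w
    (AllPairs-++⁻ˡ (v ∷ xs) v!) (AllPairs-++⁻ˡ (w ∷ xs) w!)
    (Linked-++⁻ˡ (v ∷ xs) v~) (Linked-++⁻ˡ (w ∷ xs) w~) 3≤v′ 3≤w′
  -- Dropping `z` costs `v` its third neighbour, so `z` is adjacent to `v` and closes the rim; `w`
  -- becomes the centre.
  ... | no 3≰v | _ = cycle-wheel xs z v! w∉ v~ (~-sym (deg-last v xs z 3≤v 3≰v)) 3≤w
    where
    w∉ : w ∉ v ∷ xs ∷ʳ z
    w∉ (here w≡v) = v≢w (sym w≡v)
    w∉ (there w∈) = Unique[x∷xs]⇒x∉xs w! w∈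
  ... | yes _ | no 3≰w = cycle-wheel xs z w! v∉ w~ (~-sym (deg-last w xs z 3≤w 3≰w)) 3≤v
    where
    v∉ : v ∉ w ∷ xs ∷ʳ z
    v∉ (here v≡w) = v≢w v≡w
    v∉ (there v∈) = Unique[x∷xs]⇒x∉xs v! v∈

  -- Paths and their rotation.

  record PathIn (L xs : List (Fin n)) : Set where
    field
      unique : Unique xs
      linked : Linked _~_ xs
      inside : All (_∈ L) xs

  open PathIn

  PathIn-++⁻ʳ : ∀ {L} xs {ys} → PathIn L (xs ++ ys) → PathIn L ys
  PathIn-++⁻ʳ xs p = record
    { unique = AllPairs-++⁻ʳ xs (unique p)
    ; linked = Linked-++⁻ʳ xs (linked p)
    ; inside = All-++⁻ʳ xs (inside p)
    }

  reverse-front-↭ : ∀ v w xs (ys : List (Fin n)) →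
                    v ∷ (xs ∷ʳ w) ++ ys ↭ w ∷ reverse (v ∷ xs) ++ ys
  reverse-front-↭ v w xs ys = ++⁺ʳ ys (↭-trans
    (↭-sym (↭-reverse (v ∷ xs ∷ʳ w))) (↭-reflexive (reverse-++ (v ∷ xs) [ w ])))

  -- Pósa rotation: the edge from `w` to `y` is exchanged for the one from `v` to `y`, and the
  -- vertices stay the same.
  reverse-front : ∀ {L v w y} xs ys → PathIn L (v ∷ (xs ∷ʳ w) ++ y ∷ ys) → v ~ y →
                  PathIn L (w ∷ reverse (v ∷ xs) ++ y ∷ ys)
  reverse-front {v = v} {w} {y} xs ys p v~y = record
    { unique = Unique-resp-↭ (setoid (Fin n)) (↭⇒↭ₛ perm) (unique p)
    ; linked = subst (Linked _~_) eq (Linked-ʳ++⁺ ~-sym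
        (Linked-++⁻ˡ front (linked p)) (just v~y) (Linked-++⁻ʳ front (linked p)))
    ; inside = All-resp-↭ perm (inside p)
    }
    where
    front : List (Fin n)
    front = v ∷ xs ∷ʳ w
    perm : front ++ y ∷ ys ↭ w ∷ reverse (v ∷ xs) ++ y ∷ ys
    perm = reverse-front-↭ v w xs (y ∷ ys)
    eq : front ʳ++ (y ∷ ys) ≡ w ∷ reverse (v ∷ xs) ++ y ∷ ys
    eq = trans (++-ʳ++ (v ∷ xs)) (cong (w ∷_) (ʳ++-defn (v ∷ xs)))

  -- Longest paths under minimum degree 4.

  module _ {L : List (Fin n)} (L! : Unique L) (4≤deg : ∀ {v} → v ∈ L → 4 ≤ deg v L) where

    -- Paths of length k may be treated as longest: a longer one is handed to `extended`.
    module _ {k : ℕ}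
             (extended : ∀ {xs} → PathIn L xs → length xs ≡ suc k → LongWheel G) where

      -- A neighbour of `v` in `L` off the path extends it at the front, which `extended` settles.
      -- Otherwise all neighbours of `v` in `L` are counted in `xs`, and `cont` takes over.
      end-deg : ∀ {v xs} → PathIn L (v ∷ xs) → length (v ∷ xs) ≡ k →
                (4 ≤ deg v xs → LongWheel G) → LongWheel G
      end-deg {v} {xs} p len cont
        with all? (λ u → _∈?_ _≟_ u (v ∷ xs)) (filter (v ~?_) L)
      ... | yes all∈ = cont (≤-trans (4≤deg (All.head (inside p)))
        (Unique⇒length-≤ (Unique-filter⁺ (v ~?_) L!) nbrs⊆))
        where
        nbrs⊆ : filter (v ~?_) L ⊆ filter (v ~?_) xs
        nbrs⊆ u∈ with All.lookup all∈ u∈ | proj₂ (∈-filter⁻ (v ~?_) {xs = L} u∈)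
        ... | here refl  | v~u = contradiction v~u (~-irrefl refl)
        ... | there u∈xs | v~u = ∈-filter⁺ (v ~?_) u∈xs v~u
      ... | no ¬all∈ with find (¬All⇒Any¬ (λ u → _∈?_ _≟_ u (v ∷ xs)) _ ¬all∈)
      ...   | u , u∈ , u∉ = extended (record
        { unique = ¬Any⇒All¬ _ u∉ ∷ unique p
        ; linked = ~-sym (proj₂ (∈-filter⁻ (v ~?_) {xs = L} u∈)) ∷ linked p
        ; inside = proj₁ (∈-filter⁻ (v ~?_) u∈) ∷ inside p
        }) (cong suc len)

      -- The early second neighbour of the header is reached by descent on the length of
      -- an initial segment xs that contains two neighbours of the first vertex.
      rotate : ∀ m {v} xs ys → length xs ≤ m → PathIn L (v ∷ xs ++ ys) →
               length (v ∷ xs ++ ys) ≡ k → 2 ≤ deg v xs → LongWheel G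
      rotate m xs ys xs≤m p len 2≤v with initLast xs
      rotate m .[] ys xs≤m p len () | []
      rotate zero .(xs ∷ʳ y) ys xs≤m p len 2≤v | xs ∷ʳ′ y =
        contradiction (subst (_≤ 0) (length-∷ʳ xs) xs≤m) λ ()
      rotate (suc m) {v} .(xs ∷ʳ y) ys xs≤m p len 2≤v | xs ∷ʳ′ y
        rewrite ∷ʳ-++ xs y ys with 2 ≤? deg v xs
      -- Two neighbours remain without `y`, so `y` moves to the tail.
      ... | yes 2≤v′ =
        rotate m xs (y ∷ ys) (s≤s⁻¹ (subst (_≤ suc m) (length-∷ʳ xs) xs≤m)) p len 2≤v′
      ... | no 2≰v with initLast xs
      ...   | [] = contradiction
        (≤-trans 2≤v (length-filter (v ~?_) [ y ])) λ { (s≤s ()) }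
      -- Here `y` is the second neighbour of `v` along the path, and `w` precedes it.
      ...   | us ∷ʳ′ w = at-second-neighbour (2 ≤? deg w (reverse (v ∷ us)))
        where
        v~y : v ~ y
        v~y = deg-last v (us ∷ʳ w) y 2≤v 2≰v
        q : PathIn L (w ∷ reverse (v ∷ us) ++ y ∷ ys)
        q = reverse-front us ys p v~y
        lenq : length (w ∷ reverse (v ∷ us) ++ y ∷ ys) ≡ k
        lenq = trans (sym (↭-length (reverse-front-↭ v w us (y ∷ ys)))) len
        p-tail : PathIn L (w ∷ y ∷ ys)
        p-tail = PathIn-++⁻ʳ (v ∷ us) (subst (PathIn L) (cong (v ∷_) (∷ʳ-++ us w (y ∷ ys))) p)
        v∉ : v ∉ w ∷ y ∷ ys
        v∉ v∈ = Unique[x∷xs]⇒x∉xs (unique p)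
          (subst (v ∈_) (sym (∷ʳ-++ us w (y ∷ ys))) (∈-++⁺ʳ us v∈))
        front≤m : length (reverse (v ∷ us)) ≤ m
        front≤m = s≤s⁻¹ (≤-trans (≤-reflexive (trans (cong suc (length-reverse (v ∷ us)))
          (sym (trans (length-∷ʳ (us ∷ʳ w)) (cong suc (length-∷ʳ us)))))) xs≤m)
        at-second-neighbour : Dec (2 ≤ deg w (reverse (v ∷ us))) → LongWheel G
        -- The new segment gains `v` but loses `w` and `y`, so it is shorter by one.
        at-second-neighbour (yes 2≤w) =
          rotate m (reverse (v ∷ us)) (y ∷ ys) front≤m q lenq 2≤w
        -- Each end has at most one of its at least four neighbours before `y`, which leaves three
        -- on the common tail.
        at-second-neighbour (no 2≰w) =
          end-deg p len λ 4≤v → end-deg q lenq λ 4≤w →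
          two-ends-wheel (reverseView (y ∷ ys)) (v∉ ∘ here)
            (¬Any⇒All¬ _ (v∉ ∘ there) ∷ AllPairs-++⁻ʳ [ w ] (unique p-tail)) (unique p-tail)
            (v~y ∷ Linked-++⁻ʳ [ w ] (linked p-tail)) (linked p-tail)
            (deg-tail v (us ∷ʳ w) (y ∷ ys) 4≤v 2≰v)
            (deg-tail w (reverse (v ∷ us)) (y ∷ ys) 4≤w 2≰w)

    -- This replaces the choice of a longest path: each extension lowers `d` by one, and at `d = 0`
    -- the path would have more vertices than `L`.
    extend : ∀ d {v xs} → PathIn L (v ∷ xs) → length L < length (v ∷ xs) + d → LongWheel G
    extend zero p L<p = contradiction
      (<-≤-trans L<p (≤-trans (≤-reflexive (+-identityʳ _))
        (Unique⇒length-≤ (unique p) (All.lookup (inside p)))))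
      1+n≰n
    extend (suc d) {v} {xs} p L<p =
      end-deg extended p refl λ 4≤v →
      -- The descent starts with the whole path as initial segment.
      rotate extended (length xs) xs [] ≤-refl
        (subst (PathIn L ∘ (v ∷_)) (sym (++-identityʳ xs)) p)
        (cong (suc ∘ length) (++-identityʳ xs)) (≤-trans (s≤s (s≤s z≤n)) 4≤v)
      where
      extended : ∀ {ys} → PathIn L ys → length ys ≡ suc (length (v ∷ xs)) → LongWheel G
      extended {_ ∷ _} q len = extend d q
        (subst (length L <_) (trans (+-suc _ d) (cong (_+ d) (sym len))) L<p)

    min-deg-4-wheel : ∀ {v} → v ∈ L → LongWheel G
    min-deg-4-wheel v∈L = extend (length L)
      (record { unique = [] ∷ [] ; linked = [-] ; inside = v∈L ∷ [] }) ≤-refl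

  -- Greedy colouring.

  ColoringOn : ℕ → List (Fin n) → Set
  ColoringOn k L =
    Σ[ c ∈ (Fin n → Fin k) ] (∀ {u v} → u ∈ L → v ∈ L → u ~ v → c u ≢ c v)

  -- The neighbours of `v` in `L` use fewer than `k` colours, so one is free for `v`.
  extend-coloring : ∀ {k L v} → deg v L < k →
                    ColoringOn k (filter (λ u → ¬? (u ≟ v)) L) → ColoringOn k L
  extend-coloring {k} {L} {v} deg<k (c , proper) = c′ , proper′
    where
    fresh : Σ[ x ∈ Fin k ] x ∉ map c (filter (v ~?_) L)
    fresh = ∃-fresh _ (≤-trans (≤-reflexive (cong suc (length-map c (filter (v ~?_) L)))) deg<k)
    c′ : Fin n → Fin k
    c′ u with u ≟ v
    ... | yes _ = proj₁ fresh
    ... | no  _ = c u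
    fresh≢ : ∀ {u} → u ∈ L → v ~ u → proj₁ fresh ≢ c u
    fresh≢ u∈L v~u eq = proj₂ fresh
      (subst (_∈ map c (filter (v ~?_) L)) (sym eq) (∈-map⁺ c (∈-filter⁺ (v ~?_) u∈L v~u)))
    proper′ : ∀ {u w} → u ∈ L → w ∈ L → u ~ w → c′ u ≢ c′ w
    proper′ {u} {w} u∈ w∈ u~w with u ≟ v | w ≟ v
    ... | yes refl | yes refl = contradiction u~w (~-irrefl refl)
    ... | yes refl | no  _    = fresh≢ w∈ u~w
    ... | no  _    | yes refl = ≢-sym (fresh≢ u∈ (~-sym u~w))
    ... | no  u≢v  | no  w≢v  = proper (∈-filter⁺ _ u∈ u≢v) (∈-filter⁺ _ w∈ w≢v) u~w

  -- A vertex with at most three neighbours in `L` is deleted and coloured last. The bound `m`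
  -- drives the recursion, as a filtered list is no structural part of `L`.
  coloring : ¬ LongWheel G → ∀ m {L} → Unique L → length L ≤ m → ColoringOn 4 L
  coloring noWheel m {[]} _ _ = (λ _ → zero) , λ ()
  coloring noWheel (suc m) {L@(_ ∷ _)} L! L≤m with any? (λ v → deg v L ≤? 3) L
  ... | no none = contradiction
    (min-deg-4-wheel L! (λ v∈L → ≰⇒> (none ∘ lose v∈L)) (here refl)) noWheel
  ... | yes some with find some
  ...   | v , v∈L , deg≤3 = extend-coloring (s≤s deg≤3)
    (coloring noWheel m (Unique-filter⁺ ≢v? L!)
      -- The filter rejects `v` itself, so the list gets strictly shorter.
      (s≤s⁻¹ (≤-trans (filter-notAll ≢v? L (lose v∈L λ v≢v → v≢v refl)) L≤m)))
    where
    ≢v? = λ u → ¬? (u ≟ v)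

theorem8p2 : ∀ (n : ℕ) (G : Graph n) → ¬ LongWheel G → Colorable G 4
theorem8p2 n G noWheel with coloring G noWheel n (allFin⁺ n) (≤-reflexive (length-tabulate id))
... | c , proper = c , λ u v → proper (∈-allFin u) (∈-allFin v)
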